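{- Let $(G,i)$ be a filter pair over the signature $\Sigma$. (i) For any homomorphism of $\Sigma$-structures $f:A\to B$ and $\Gamma\cup\{\varphi\}\subseteq A$: $\Gamma\vdash^A\varphi\ \Rightarrow\ f[\Gamma]\vdash^B f(\varphi)$. (ii) For any injective map of sets $f:X\to Y$ and $\Gamma\cup\{\varphi\}\subseteq Fm(X)$: $\Gamma\vdash^X\varphi\ \Leftrightarrow\ f[\Gamma]\vdash^Y f(\varphi)$, where $f$ also denotes the induced homomorphism $Fm(X)\to Fm(Y)$.
   Context: $\Sigma$-Str is the category of $\Sigma$-structures and homomorphisms; $Fm(X)$ is the absolutely free $\Sigma$-structure on a set $X$. $AL$ is the category of algebraic lattices with maps preserving arbitrary meets and directed joins. A filter pair over $\Sigma$ is a pair $(G,i)$ of a contravariant functor $G:\Sigma\text{ -Str}\to AL$ and maps $i_A:G(A)\to(\mathcal{P}(A),\subseteq)$, one for each $\Sigma$-structure $A$, preserving arbitrary infima (in particular $i_A(\top)=A$) and directed suprema, such that $i_A\circ G(h)=h^{ -1}\circ i_B$ for every homomorphism $h:A\to B$. For a $\Sigma$-structure $A$ and $\Gamma\cup\{\varphi\}\subseteq A$: $\Gamma\vdash^A\varphi$ iff for every $a\in G(A)$, $\Gamma\subseteq i_A(a)$ implies $\varphi\in i_A(a)$. For a set $X$, $\vdash^X$ denotes $\vdash^{Fm(X)}$. -}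

module Defs where

open import Level using (Level; _⊔_; suc)
open import Data.Nat.Base using (ℕ)
open import Data.Product.Base using (_×_; _,_; ∃; ∃-syntax)
open import Data.Vec.Base as Vec using (Vec; []; _∷_)
open import Data.Vec.Properties using (map-id; map-∘)
open import Function.Base using (id; _∘_)
open import Relation.Binary.Bundles using (Poset)
open import Relation.Binary.Morphism.Bundles using (PosetHomomorphism)
open import Relation.Binary.PropositionalEquality
  using (_≡_; _≗_; refl; sym; trans; cong; cong₂)
open import Relation.Unary using (Pred; _∈_; _⊆_; _≐_; _⊢_)
open import Relation.Unary.Relation.Binary.Subset using (⊆-poset)

private
  variable
    ℓ c c′ ℓ₁ ℓ₁′ ℓ₂ ℓ₂′ : Level

-- Subsets of a lattice are presented as families x : I → Carrier with
-- I : Set ι.  "Arbitrary" meets and joins are those of all such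
-- families; the carrier level is independent of ι, so that the powerset
-- Pred A ι of a set A : Set ι is included.

module _ (P : Poset c ℓ₁ ℓ₂) where
  open Poset P

  IsMeet IsJoin : ∀ {ι} {I : Set ι} → (I → Carrier) → Carrier → Set (ι ⊔ c ⊔ ℓ₂)
  IsMeet x m = (∀ i → m ≤ x i) × (∀ y → (∀ i → y ≤ x i) → y ≤ m)
  IsJoin x j = (∀ i → x i ≤ j) × (∀ y → (∀ i → x i ≤ y) → j ≤ y)

  IsDirected : ∀ {ι} {I : Set ι} → (I → Carrier) → Set (ι ⊔ ℓ₂)
  IsDirected {I = I} x = I × (∀ i j → ∃[ k ] (x i ≤ x k × x j ≤ x k))

  IsCompact : ∀ ι → Pred Carrier (suc ι ⊔ c ⊔ ℓ₂)
  IsCompact ι a = ∀ {I : Set ι} (x : I → Carrier) (j : Carrier) →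
    IsDirected x → IsJoin x j → a ≤ j → ∃[ i ] a ≤ x i

record AlgebraicLattice (ι c ℓ₁ ℓ₂ : Level) : Set (suc (ι ⊔ c ⊔ ℓ₁ ⊔ ℓ₂)) where
  field
    poset : Poset c ℓ₁ ℓ₂

  open Poset poset public

  field
    hasMeets  : {I : Set ι} (x : I → Carrier) → ∃ (IsMeet poset x)
    hasJoins  : {I : Set ι} (x : I → Carrier) → ∃ (IsJoin poset x)
    algebraic : ∀ a → ∃[ I ] ∃[ k ]
      ((∀ (i : I) → IsCompact poset ι (k i)) × IsJoin poset {ι = ι} k a)

-- Monotonicity and congruence, part of PosetHomomorphism, already follow
-- from preservation of binary meets.
record Continuous (ι : Level) (P : Poset c ℓ₁ ℓ₂) (Q : Poset c′ ℓ₁′ ℓ₂′)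
       : Set (suc ι ⊔ c ⊔ ℓ₁ ⊔ ℓ₂ ⊔ c′ ⊔ ℓ₁′ ⊔ ℓ₂′) where
  field
    homomorphism : PosetHomomorphism P Q

  open PosetHomomorphism homomorphism public using (⟦_⟧)

  field
    preserves-meets : {I : Set ι} (x : I → Poset.Carrier P) (m : Poset.Carrier P) →
      IsMeet P x m → IsMeet Q (⟦_⟧ ∘ x) ⟦ m ⟧
    preserves-directed-joins : {I : Set ι} (x : I → Poset.Carrier P) (j : Poset.Carrier P) →
      IsDirected P x → IsJoin P x j → IsJoin Q (⟦_⟧ ∘ x) ⟦ j ⟧

record Signature (ℓ : Level) : Set (suc ℓ) where
  field
    Op : ℕ → Set ℓ

record Structure (S : Signature ℓ) : Set (suc ℓ) where
  open Signature S
  field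
    Carrier : Set ℓ
    ⟪_⟫     : ∀ {n} → Op n → Vec Carrier n → Carrier

record Hom {S : Signature ℓ} (A B : Structure S) : Set ℓ where
  open Signature S
  private
    module A = Structure A
    module B = Structure B
  field
    fun      : A.Carrier → B.Carrier
    preserve : ∀ {n} (o : Op n) as → fun (A.⟪ o ⟫ as) ≡ B.⟪ o ⟫ (Vec.map fun as)

open Hom public using (fun)

module _ {S : Signature ℓ} where

  idHom : (A : Structure S) → Hom A A
  idHom A = record
    { fun      = id
    ; preserve = λ o as → cong (Structure.⟪_⟫ A o) (sym (map-id as))
    }

  infixr 9 _∘ₕ_

  _∘ₕ_ : {A B C : Structure S} → Hom B C → Hom A B → Hom A C
  _∘ₕ_ {C = C} g f = record
    { fun      = fun g ∘ fun f
    ; preserve = λ o as → trans (cong (fun g) (Hom.preserve f o as))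
        (trans (Hom.preserve g o (Vec.map (fun f) as))
               (cong (Structure.⟪_⟫ C o) (sym (map-∘ (fun g) (fun f) as))))
    }

module _ (S : Signature ℓ) where
  open Signature S

  data Term (X : Set ℓ) : Set ℓ where
    var : X → Term X
    app : ∀ {n} → Op n → Vec (Term X) n → Term X

  Fm : Set ℓ → Structure S
  Fm X = record { Carrier = Term X ; ⟪_⟫ = app }

module _ {S : Signature ℓ} {X : Set ℓ} (A : Structure S) where
  open Structure A

  mutual
    eval : (X → Carrier) → Term S X → Carrier
    eval v (var x)    = v x
    eval v (app o ts) = ⟪ o ⟫ (evals v ts)

    -- Vec.map (eval v), unfolded for the termination checker.
    evals : ∀ {n} → (X → Carrier) → Vec (Term S X) n → Vec Carrier n
    evals v []       = []
    evals v (t ∷ ts) = eval v t ∷ evals v ts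

  evals≡map : ∀ {n} v (ts : Vec (Term S X) n) → evals v ts ≡ Vec.map (eval v) ts
  evals≡map v []       = refl
  evals≡map v (t ∷ ts) = cong (eval v t ∷_) (evals≡map v ts)

  extend : (X → Carrier) → Hom (Fm S X) A
  extend v = record
    { fun      = eval v
    ; preserve = λ o ts → cong ⟪ o ⟫ (evals≡map v ts)
    }

  mutual
    extend-unique : (h : Hom (Fm S X) A) → fun h ≗ fun (extend (fun h ∘ var))
    extend-unique h (var x)    = refl
    extend-unique h (app o ts) =
      trans (Hom.preserve h o ts) (cong ⟪ o ⟫ (extend-uniques h ts))

    extend-uniques : ∀ {n} (h : Hom (Fm S X) A) (ts : Vec (Term S X) n) →
      Vec.map (fun h) ts ≡ evals (fun h ∘ var) ts
    extend-uniques h []       = refl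
    extend-uniques h (t ∷ ts) = cong₂ _∷_ (extend-unique h t) (extend-uniques h ts)

Fm₁ : (S : Signature ℓ) {X Y : Set ℓ} → (X → Y) → Hom (Fm S X) (Fm S Y)
Fm₁ S {Y = Y} f = extend (Fm S Y) (var ∘ f)

record FilterPair (S : Signature ℓ) (c ℓ₁ ℓ₂ : Level) : Set (suc (ℓ ⊔ c ⊔ ℓ₁ ⊔ ℓ₂)) where
  open Structure using (Carrier)
  field
    G₀ : Structure S → AlgebraicLattice ℓ c ℓ₁ ℓ₂

  private
    module G (A : Structure S) = AlgebraicLattice (G₀ A)

  field
    G₁ : {A B : Structure S} → Hom A B → Continuous ℓ (G.poset B) (G.poset A)
    i  : (A : Structure S) → Continuous ℓ (G.poset A) (⊆-poset (Carrier A) ℓ)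

  G⟨_⟩ : {A B : Structure S} → Hom A B → G.Carrier B → G.Carrier A
  G⟨ h ⟩ = Continuous.⟦_⟧ (G₁ h)

  i⟨_⟩ : (A : Structure S) → G.Carrier A → Pred (Carrier A) ℓ
  i⟨ A ⟩ = Continuous.⟦_⟧ (i A)

  field
    -- Homomorphisms are equal when they agree pointwise, so G has to be
    -- well defined with respect to that equality.
    G-resp-≗ : {A B : Structure S} (g h : Hom A B) → fun g ≗ fun h →
      ∀ b → G._≈_ A (G⟨ g ⟩ b) (G⟨ h ⟩ b)
    G-id     : (A : Structure S) → ∀ a → G._≈_ A (G⟨ idHom A ⟩ a) a
    G-∘      : {A B C : Structure S} (g : Hom B C) (f : Hom A B) →
      ∀ c → G._≈_ A (G⟨ g ∘ₕ f ⟩ c) (G⟨ f ⟩ (G⟨ g ⟩ c))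
    natural  : {A B : Structure S} (h : Hom A B) →
      ∀ b → i⟨ A ⟩ (G⟨ h ⟩ b) ≐ (fun h ⊢ i⟨ B ⟩ b)

  Entails : (A : Structure S) → Pred (Carrier A) ℓ → Carrier A → Set (ℓ ⊔ c)
  Entails A Γ φ = (a : G.Carrier A) → Γ ⊆ i⟨ A ⟩ a → φ ∈ i⟨ A ⟩ a

  syntax Entails A Γ φ = Γ ⊢[ A ] φ

image : {A B : Set ℓ} → (A → B) → Pred A ℓ → Pred B ℓ
image f Γ b = ∃[ a ] (a ∈ Γ × f a ≡ b)

{-# OPTIONS --safe #-}
-- (i) is naturality: fun f ⊢ i_B b is the filter i_A (G f b) of A.  For the
-- converse in (ii), an injection f : X → Y induces a split mono Fm X → Fm Y,
-- and applying (i) to a retraction undoes f.  Variables outside the range of f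
-- may go to any term; sending them to φ itself avoids a case split on whether
-- X is empty.
module Submission where

open import Defs
open import Level using (Level)
open import Axiom.ExcludedMiddle using (ExcludedMiddle)
open import Data.Empty using (⊥-elim)
open import Data.Product.Base using (_×_; _,_; ∃-syntax; proj₁; proj₂)
open import Data.Vec.Base using (Vec; []; _∷_)
open import Function.Base using (id; _∘_)
open import Function.Bundles using (_⇔_; mk⇔)
open import Function.Definitions using (Injective)
open import Relation.Binary.PropositionalEquality
  using (_≡_; _≗_; refl; sym; trans; cong; cong₂; subst)
open import Relation.Nullary.Decidable.Core using (yes; no)
open import Relation.Unary using (Pred)

private
  variable
    ℓ c ℓ₁ ℓ₂ : Level

module _ {S : Signature ℓ} {X : Set ℓ} (A : Structure S) where
  open Structure A

  mutual
    eval-cong : {v w : X → Carrier} → v ≗ w → eval {S = S} A v ≗ eval A w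
    eval-cong v≗w (var x)    = v≗w x
    eval-cong v≗w (app o ts) = cong ⟪ o ⟫ (evals-cong v≗w ts)

    evals-cong : ∀ {n} {v w : X → Carrier} → v ≗ w →
      (ts : Vec (Term S X) n) → evals {S = S} A v ts ≡ evals A w ts
    evals-cong v≗w []       = refl
    evals-cong v≗w (t ∷ ts) = cong₂ _∷_ (eval-cong v≗w t) (evals-cong v≗w ts)

  -- Both homomorphisms are extensions of their values on variables. Those values agree only
  -- pointwise, so `eval-cong` stands in for function extensionality.
  hom-ext : (g h : Hom (Fm S X) A) → fun g ∘ var ≗ fun h ∘ var → fun g ≗ fun h
  hom-ext g h g≗h t = trans (extend-unique A g t)
    (trans (eval-cong g≗h t) (sym (extend-unique A h t)))

-- Excluded middle decides whether a point of `Y` lies in the range of `f`; `z` is the value at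
-- points that do not.
extend-along-injective : ExcludedMiddle ℓ → {X Y Z : Set ℓ} (f : X → Y) →
  Injective _≡_ _≡_ f → (v : X → Z) → Z → ∃[ g ] g ∘ f ≗ v
extend-along-injective em {X} {Y} {Z} f f-inj v z = g , g∘f≗v
  where
  g : Y → Z
  g y with em {∃[ x ] f x ≡ y}
  ... | yes (x , _) = v x
  ... | no _        = z

  g∘f≗v : g ∘ f ≗ v
  -- Repeating the case split of `g` lets `g (f x)` reduce. The preimage found need not be `x`
  -- itself, so injectivity identifies the two.
  g∘f≗v x with em {∃[ x′ ] f x′ ≡ f x}
  ... | yes (_ , fx′≡fx) = cong v (f-inj fx′≡fx)
  ... | no ∄x′           = ⊥-elim (∄x′ (x , refl))

Fm₁-retraction : ExcludedMiddle ℓ → {S : Signature ℓ} {X Y : Set ℓ} (f : X → Y) →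
  Injective _≡_ _≡_ f → Term S X →
  ∃[ r ] fun {A = Fm S Y} {B = Fm S X} r ∘ fun (Fm₁ S f) ≗ id
Fm₁-retraction em {S} {X} f f-inj t
  with g , g∘f≗var ← extend-along-injective em f f-inj var t =
  -- On `var x` the composite computes to `g (f x)`, so `g∘f≗var` is already agreement on variables.
  r , hom-ext (Fm S X) (r ∘ₕ Fm₁ S f) (idHom (Fm S X)) g∘f≗var
  where
  r = extend (Fm S X) g

module _ {S : Signature ℓ} (F : FilterPair S c ℓ₁ ℓ₂) where
  open FilterPair F
  open Structure using (Carrier)

  entails-image : (A B : Structure S) (f : Hom A B) (Γ : Pred (Carrier A) ℓ) (φ : Carrier A) →
    Γ ⊢[ A ] φ → image (fun f) Γ ⊢[ B ] fun f φ
  -- The image of Γ lies in `i⟨ B ⟩ b` exactly when Γ lies in the preimage, which is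
  -- `i⟨ A ⟩ (G⟨ f ⟩ b)`; so the hypothesis is tested at `G⟨ f ⟩ b`.
  entails-image A B f Γ φ Γ⊢φ b fΓ⊆b = proj₁ (natural f b)
    (Γ⊢φ (G⟨ f ⟩ b) λ γ∈Γ → proj₂ (natural f b) (fΓ⊆b (_ , γ∈Γ , refl)))

  entails-reflect : {A B : Structure S} (f : Hom A B) (r : Hom B A) → fun r ∘ fun f ≗ id →
    (Γ : Pred (Carrier A) ℓ) (φ : Carrier A) →
    image (fun f) Γ ⊢[ B ] fun f φ → Γ ⊢[ A ] φ
  entails-reflect {A} {B} f r rf≗id Γ φ fΓ⊢fφ a Γ⊆a = subst (i⟨ A ⟩ a) (rf≗id φ)
    (entails-image B A r (image (fun f) Γ) (fun f φ) fΓ⊢fφ a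
      -- Each element of the twofold image has the form r(f(γ)) with γ in Γ, hence equals γ.
      λ { (_ , (γ , γ∈Γ , refl) , refl) → subst (i⟨ A ⟩ a) (sym (rf≗id γ)) (Γ⊆a γ∈Γ) })

proposition2p13 : {ℓ c ℓ₁ ℓ₂ : Level} {S : Signature ℓ} (F : FilterPair S c ℓ₁ ℓ₂) →
    let open FilterPair F in
    -- (i)
    ((A B : Structure S) (f : Hom A B)
    (Γ : Pred (Structure.Carrier A) ℓ) (φ : Structure.Carrier A) →
    Γ ⊢[ A ] φ → image (fun f) Γ ⊢[ B ] fun f φ)
    ×
    -- (ii), classically: excluded middle is assumed
    (ExcludedMiddle ℓ →
    (X Y : Set ℓ) (f : X → Y) → Injective _≡_ _≡_ f →
    (Γ : Pred (Term S X) ℓ) (φ : Term S X) →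
    Γ ⊢[ Fm S X ] φ ⇔ image (fun (Fm₁ S f)) Γ ⊢[ Fm S Y ] fun (Fm₁ S f) φ)
proposition2p13 {S = S} F = entails-image F , λ em X Y f f-inj Γ φ →
  let r , rf≗id = Fm₁-retraction em f f-inj φ in
  mk⇔ (entails-image F (Fm S X) (Fm S Y) (Fm₁ S f) Γ φ)
      (entails-reflect F (Fm₁ S f) r rf≗id Γ φ)
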